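{- Let $t=t(n)$ be a positive integer with $t\big/\sqrt[3]{n/\log^2 n}\to 0$ as $n\to\infty$. Then the number of $t$ error correcting codes in $\mathcal P(n)$ is at most $2^{H(n,t)(1+o(1))}$, where $o(1)\to0$ as $n\to\infty$.
   Context: Subsets of $[n]$ are identified with $0/1$ strings of length $n$. The Hamming distance is $d(A,B)=|A\setminus B|+|B\setminus A|$. A family $\mathcal C\subseteq\mathcal P(n)$ is a $t$ error correcting code if $d(A,B)\ge 2t+1$ for all distinct $A,B\in\mathcal C$. Let $V(n,t)=\sum_{k=0}^t\binom nk$ and $H(n,t)=2^n/V(n,t)$. Logarithms are base 2. -}

module Defs where

open import Data.Bool using (Bool; true; false; _≟_)
open import Data.Nat using (ℕ; zero; suc; _+_; _*_; _^_; _≤_; _<_; _≤?_)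
open import Data.Nat.Combinatorics using (_C_)
open import Data.Vec using (Vec; []; _∷_)
open import Data.List using (List; []; _∷_; map; _++_; length; filter)
open import Data.List.Relation.Unary.AllPairs using (AllPairs; allPairs?)
open import Relation.Nullary using (Dec; does)

Sub : ℕ → Set
Sub n = Vec Bool n

allSubs : (n : ℕ) → List (Sub n)
allSubs zero = [] ∷ []
allSubs (suc n) = map (false ∷_) (allSubs n) ++ map (true ∷_) (allSubs n)

dist : {n : ℕ} → Sub n → Sub n → ℕ
dist [] [] = 0
dist (a ∷ as) (b ∷ bs) with does (a ≟ b)
... | true  = dist as bs
... | false = suc (dist as bs)

-- All sublists (subfamilies) of a list; applied to a duplicate-free list
-- this enumerates every subset of its elements exactly once.
sublists : {A : Set} → List A → List (List A)
sublists [] = [] ∷ []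
sublists (x ∷ xs) = sublists xs ++ map (x ∷_) (sublists xs)

-- A family (listed without repetition) is a t error correcting code if
-- any two distinct members are at distance ≥ 2t+1.
IsCode : {n : ℕ} → ℕ → List (Sub n) → Set
IsCode t C = AllPairs (λ A B → 2 * t + 1 ≤ dist A B) C

isCode? : {n : ℕ} (t : ℕ) (C : List (Sub n)) → Dec (IsCode t C)
isCode? t = allPairs? (λ A B → 2 * t + 1 ≤? dist A B)

numCodes : ℕ → ℕ → ℕ
numCodes n t = length (filter (isCode? t) (sublists (allSubs n)))

V : ℕ → ℕ → ℕ
V n zero = n C 0
V n (suc t) = V n t + n C (suc t)

{-# OPTIONS --safe #-}

-- Codes are the independent sets of the graph joining x and y when dist x y ≤ 2t; they are
-- counted by the Kleitman–Winston algorithm. Write N = 2 ^ n and v = V n t. Counting, over all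
-- centres z, the pairs of members of a family F that lie in the radius-t ball at z, and using that
-- two balls with distinct centres share at most 2 V(n-1, t-1) ≤ 2 (t/n) v points, Cauchy–Schwarz
-- shows that a family with |F| v > (1 + 1/3k) N has a member of degree at least |F|/b, where b is
-- about 8 t k N / (n v). Branching on such a member removes a fraction 1/b of F, so after
-- q ≈ b log v choices at most (1 + 1/3k) N/v sets are left. The total cost of the choices is
-- q log v ≈ t³ log² n / n · N/v bits, which the hypothesis on t makes negligible against N/v.
module Submission where

open import Defs
open import Data.Bool using (true; false; if_then_else_)
import Data.Bool.Properties as Bool
open import Data.List using (List; []; _∷_; map; _++_; length; filter)
open import Data.List.Properties using (filter-++; length-++; length-map; length-filter; map-++; map-∘)
open import Data.List.Membership.Propositional using (_∈_; find)
open import Data.List.Membership.Propositional.Properties using (∈-∃++; ∈-map⁻)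
open import Data.List.Relation.Binary.Disjoint.Propositional using (Disjoint)
open import Data.List.Relation.Binary.Permutation.Propositional using (_↭_; ↭⇒↭ₛ; ↭-refl; prep; swap)
open import Data.List.Relation.Binary.Permutation.Propositional.Properties using (shift; ↭-length)
import Data.List.Relation.Binary.Permutation.Setoid.Properties as ↭ₛ
open import Data.List.Relation.Unary.All as All using (All; []; _∷_)
open import Data.List.Relation.Unary.All.Properties using (¬Any⇒All¬)
open import Data.List.Relation.Unary.AllPairs using (AllPairs; []; _∷_; allPairs?)
open import Data.List.Relation.Unary.Any using (any?)
open import Data.List.Relation.Unary.Unique.Propositional using (Unique)
import Data.List.Relation.Unary.Unique.Propositional.Properties as Unique
open import Data.Nat
open import Data.Nat.Combinatorics using (_C_; nCk+nC[k+1]≡[n+1]C[k+1])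
open import Data.Nat.DivMod using (m≡m%n+[m/n]*n; m%n<n; m/n*n≤m)
open import Data.Nat.ListAction using (sum)
open import Data.Nat.ListAction.Properties using (sum-++)
open import Data.Nat.Logarithm using (⌊log₂_⌋; ⌊log₂⌋-mono-≤; ⌊log₂[2^n]⌋≡n)
open import Data.Nat.Properties
open import Data.Nat.Tactic.RingSolver using (solve-∀)
open import Data.Product using (∃; _×_; _,_; proj₂)
open import Data.Vec using ([]; _∷_)
open import Data.Vec.Properties using (≡-dec)
open import Function using (_∘_)
open import Relation.Binary.Definitions using () renaming (Decidable to Decidable₂; Symmetric to Symmetric₂)
open import Relation.Binary.PropositionalEquality
open import Relation.Nullary using (¬_; Dec; yes; no; contradiction; does)
open import Relation.Unary using (Decidable)

private variable
  A B : Set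

+-interchange : ∀ a b c d → (a + b) + (c + d) ≡ (a + c) + (b + d)
+-interchange = solve-∀

-- Counting subfamilies

length-filter-map : {P : B → Set} (P? : Decidable P) (f : A → B) (xs : List A) →
  length (filter P? (map f xs)) ≡ length (filter (P? ∘ f) xs)
length-filter-map P? f [] = refl
length-filter-map P? f (x ∷ xs) with P? (f x)
... | yes _ = cong suc (length-filter-map P? f xs)
... | no  _ = length-filter-map P? f xs

-- The predicate stays arbitrary because recursion on the list replaces `P` by `P ∘ (x ∷_)`, the
-- condition on the rest of a family once `x` is chosen.
countSub : {P : List A → Set} → Decidable P → List A → ℕ
countSub P? F = length (filter P? (sublists F))

countSub-∷ : {P : List A → Set} (P? : Decidable P) (x : A) (F : List A) →
  countSub P? (x ∷ F) ≡ countSub P? F + countSub (P? ∘ (x ∷_)) F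
countSub-∷ P? x F = begin
  length (filter P? (sublists F ++ map (x ∷_) (sublists F)))
    ≡⟨ cong length (filter-++ P? (sublists F) _) ⟩
  length (filter P? (sublists F) ++ filter P? (map (x ∷_) (sublists F)))
    ≡⟨ length-++ (filter P? (sublists F)) ⟩
  countSub P? F + length (filter P? (map (x ∷_) (sublists F)))
    ≡⟨ cong (countSub P? F +_) (length-filter-map P? (x ∷_) (sublists F)) ⟩
  countSub P? F + countSub (P? ∘ (x ∷_)) F ∎
  where open ≡-Reasoning

countSub≤2^length : {P : List A → Set} (P? : Decidable P) (F : List A) → countSub P? F ≤ 2 ^ length F
countSub≤2^length P? [] = length-filter P? ([] ∷ [])
countSub≤2^length P? (x ∷ F) = begin
  countSub P? (x ∷ F)                      ≡⟨ countSub-∷ P? x F ⟩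
  countSub P? F + countSub (P? ∘ (x ∷_)) F ≤⟨ +-mono-≤ (countSub≤2^length P? F) (countSub≤2^length _ F) ⟩
  2 ^ length F + 2 ^ length F              ≡⟨ cong (2 ^ length F +_) (sym (+-identityʳ _)) ⟩
  2 ^ length (x ∷ F)                       ∎
  where open ≤-Reasoning

countSub-none : {P : List A → Set} (P? : Decidable P) (F : List A) → (∀ S → ¬ P S) → countSub P? F ≡ 0
countSub-none P? [] ¬P with P? []
... | yes p = contradiction p (¬P [])
... | no  _ = refl
countSub-none P? (x ∷ F) ¬P = trans (countSub-∷ P? x F)
  (cong₂ _+_ (countSub-none P? F ¬P) (countSub-none _ F (¬P ∘ (x ∷_))))

-- A sublist containing an element outside `Q` is never counted on the left, so such elements can be
-- deleted from `F` first. It serves for the families containing a chosen `v`, with `Q` being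
-- compatibility with `v`.
countSub-filter : {P P′ : List A → Set} {Q : A → Set}
  (P? : Decidable P) (P′? : Decidable P′) (Q? : Decidable Q) →
  (∀ S → P S → All Q S × P′ S) → ∀ F → countSub P? F ≤ countSub P′? (filter Q? F)
countSub-filter P? P′? Q? imp [] with P? [] | P′? []
... | yes p | no ¬p′ = contradiction (proj₂ (imp [] p)) ¬p′
... | yes _ | yes _  = ≤-refl
... | no  _ | _      = z≤n
countSub-filter {P = P} P? P′? Q? imp (x ∷ F) with Q? x
... | yes _ = begin
  countSub P? (x ∷ F)                      ≡⟨ countSub-∷ P? x F ⟩
  countSub P? F + countSub (P? ∘ (x ∷_)) F
    ≤⟨ +-mono-≤ (countSub-filter P? P′? Q? imp F) (countSub-filter _ _ Q? imp′ F) ⟩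
  countSub P′? (filter Q? F) + countSub (P′? ∘ (x ∷_)) (filter Q? F)
    ≡⟨ countSub-∷ P′? x (filter Q? F) ⟨
  countSub P′? (x ∷ filter Q? F)           ∎
  where
  open ≤-Reasoning
  imp′ : ∀ S → P (x ∷ S) → _
  imp′ S p with imp (x ∷ S) p
  ... | _ ∷ qs , p′ = qs , p′
... | no ¬q = begin
  countSub P? (x ∷ F)                      ≡⟨ countSub-∷ P? x F ⟩
  countSub P? F + countSub (P? ∘ (x ∷_)) F ≡⟨ cong (countSub P? F +_) (countSub-none _ F ¬Px) ⟩
  countSub P? F + 0                        ≡⟨ +-identityʳ _ ⟩
  countSub P? F                            ≤⟨ countSub-filter P? P′? Q? imp F ⟩
  countSub P′? (filter Q? F)               ∎
  where
  open ≤-Reasoning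
  ¬Px : ∀ S → ¬ P (x ∷ S)
  ¬Px S p with imp (x ∷ S) p
  ... | q ∷ _ , _ = ¬q q

countSub-mono : {P P′ : List A → Set} (P? : Decidable P) (P′? : Decidable P′) →
  (∀ S → P S → P′ S) → ∀ F → countSub P? F ≤ countSub P′? F
countSub-mono P? P′? imp [] with P? [] | P′? []
... | yes p | no ¬p′ = contradiction (imp [] p) ¬p′
... | yes _ | yes _  = ≤-refl
... | no  _ | _      = z≤n
countSub-mono P? P′? imp (x ∷ F) = begin
  countSub P? (x ∷ F)                        ≡⟨ countSub-∷ P? x F ⟩
  countSub P? F + countSub (P? ∘ (x ∷_)) F
    ≤⟨ +-mono-≤ (countSub-mono P? P′? imp F) (countSub-mono _ _ (imp ∘ (x ∷_)) F) ⟩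
  countSub P′? F + countSub (P′? ∘ (x ∷_)) F ≡⟨ countSub-∷ P′? x F ⟨
  countSub P′? (x ∷ F)                       ∎
  where open ≤-Reasoning

-- Sublists keep the order of the list, so splitting on an element in the middle requires moving it
-- to the front; invariance of `P` under permutation allows this.
countSub-remove : {P : List A → Set} (P? : Decidable P) → (∀ {S T} → S ↭ T → P S → P T) → ∀ xs v ys →
  countSub P? (xs ++ v ∷ ys) ≤ countSub P? (xs ++ ys) + countSub (P? ∘ (v ∷_)) (xs ++ ys)
countSub-remove P? resp [] v ys = ≤-reflexive (countSub-∷ P? v ys)
countSub-remove P? resp (x ∷ xs) v ys = begin
  countSub P? (x ∷ xs ++ v ∷ ys)
    ≡⟨ countSub-∷ P? x (xs ++ v ∷ ys) ⟩
  countSub P? (xs ++ v ∷ ys) + countSub (P? ∘ (x ∷_)) (xs ++ v ∷ ys)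
    ≤⟨ +-mono-≤ (countSub-remove P? resp xs v ys) (countSub-remove _ (resp ∘ prep x) xs v ys) ⟩
  (c P? + c (P? ∘ (v ∷_))) + (c (P? ∘ (x ∷_)) + c (P? ∘ (x ∷_) ∘ (v ∷_)))
    ≤⟨ +-monoʳ-≤ (c P? + c (P? ∘ (v ∷_))) (+-monoʳ-≤ (c (P? ∘ (x ∷_)))
         (countSub-mono _ _ (λ S → resp (swap x v ↭-refl)) (xs ++ ys))) ⟩
  (c P? + c (P? ∘ (v ∷_))) + (c (P? ∘ (x ∷_)) + c (P? ∘ (v ∷_) ∘ (x ∷_)))
    ≡⟨ +-interchange (c P?) _ _ _ ⟩
  (c P? + c (P? ∘ (x ∷_))) + (c (P? ∘ (v ∷_)) + c (P? ∘ (v ∷_) ∘ (x ∷_)))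
    ≡⟨ cong₂ _+_ (countSub-∷ P? x (xs ++ ys)) (countSub-∷ (P? ∘ (v ∷_)) x (xs ++ ys)) ⟨
  countSub P? (x ∷ xs ++ ys) + countSub (P? ∘ (v ∷_)) (x ∷ xs ++ ys) ∎
  where
  open ≤-Reasoning
  c : {Q : List _ → Set} → Decidable Q → ℕ
  c Q? = countSub Q? (xs ++ ys)

-- The Kleitman-Winston algorithm

module Container {A : Set} {R : A → A → Set} (R? : Decidable₂ R)
  (R-sym : Symmetric₂ R) (R-irrefl : ∀ x → ¬ R x x) where

  AllPairs-↭ : ∀ {S T} → S ↭ T → AllPairs R S → AllPairs R T
  AllPairs-↭ S↭T = ↭ₛ.AllPairs-resp-↭ (setoid A) R-sym ((λ { refl r → r }) , (λ { refl r → r })) (↭⇒↭ₛ S↭T)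

  -- `R` is compatibility, so the families counted are the independent sets of the graph whose edges
  -- join incompatible elements.
  count : List A → ℕ
  count = countSub (allPairs? R?)

  -- A family either omits `v`, or contains it and then draws all its other members from those
  -- compatible with `v`.
  count-branch : ∀ xs v ys → count (xs ++ v ∷ ys) ≤ count (xs ++ ys) + count (filter (R? v) (xs ++ ys))
  count-branch xs v ys = ≤-trans (countSub-remove (allPairs? R?) AllPairs-↭ xs v ys)
    (+-monoʳ-≤ (count (xs ++ ys))
      (countSub-filter _ (allPairs? R?) (R? v) (λ { _ (r ∷ rs) → r , rs }) (xs ++ ys)))

  -- Bridges `pick`, which filters all of `F`, and the branch on `v`, which filters `F` without `v`.
  filter-self : ∀ xs v ys → filter (R? v) (xs ++ v ∷ ys) ≡ filter (R? v) (xs ++ ys)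
  filter-self [] v ys with R? v v
  ... | yes r = contradiction r (R-irrefl v)
  ... | no  _ = refl
  filter-self (x ∷ xs) v ys with R? v x
  ... | yes _ = cong (x ∷_) (filter-self xs v ys)
  ... | no  _ = filter-self xs v ys

  -- The weight (1 + 1/X)^|F| X^q absorbs both branches exactly:
  -- dropping v costs a factor 1 + 1/X, and choosing v one unit of q.
  container-bound : ∀ X .{{_ : NonZero X}} b M →
    (∀ F → Unique F → M < length F →
       ∃ λ v → v ∈ F × suc b * length (filter (R? v) F) ≤ b * length F) →
    ∀ s q F → Unique F → length F ≤ s → length F * b ^ q < suc M * suc b ^ q →
    count F * X ^ s ≤ suc X ^ s * X ^ q * 2 ^ M
  container-bound X b M pick = go
    where
    open ≤-Reasoning
    -- `s` bounds the size of the family and drops on both branches; `q` bounds the number of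
    -- choices still to come and drops only when `v` is chosen.
    go : ∀ s q F → Unique F → length F ≤ s → length F * b ^ q < suc M * suc b ^ q →
         count F * X ^ s ≤ suc X ^ s * X ^ q * 2 ^ M
    go s q F uF F≤s small with length F ≤? M
    go s q F uF F≤s small | yes F≤M = begin
      count F * X ^ s           ≤⟨ *-mono-≤ (≤-trans (countSub≤2^length _ F) (^-monoʳ-≤ 2 F≤M))
                                     (^-monoˡ-≤ s (n≤1+n X)) ⟩
      2 ^ M * suc X ^ s         ≡⟨ *-comm (2 ^ M) (suc X ^ s) ⟩
      suc X ^ s * 2 ^ M         ≤⟨ *-monoˡ-≤ (2 ^ M) (m≤m*n (suc X ^ s) (X ^ q) {{m^n≢0 X q}}) ⟩
      suc X ^ s * X ^ q * 2 ^ M ∎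
    -- With no choices left, `small` says that the family already has at most `M` members.
    go s zero F uF F≤s small | no F≰M =
      contradiction (s≤s⁻¹ (subst₂ _<_ (*-identityʳ _) (*-identityʳ _) small)) F≰M
    go zero (suc q) F uF F≤s small | no F≰M = contradiction (≤-trans F≤s z≤n) F≰M
    go (suc s) (suc q) F uF F≤s small | no F≰M with pick F uF (≰⇒> F≰M)
    ... | v , v∈F , few with ∈-∃++ v∈F
    ... | xs , ys , refl = begin
      count F * (X * X ^ s)
        ≤⟨ *-monoˡ-≤ (X * X ^ s) (count-branch xs v ys) ⟩
      (count F₁ + count F₂) * (X * X ^ s)
        ≡⟨ distrib (count F₁) (count F₂) X (X ^ s) ⟩
      X * (count F₁ * X ^ s) + X * (count F₂ * X ^ s)
        ≤⟨ +-mono-≤ (*-monoʳ-≤ X (go s (suc q) F₁ uF₁ F₁≤s small₁))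
                    (*-monoʳ-≤ X (go s q F₂ uF₂ F₂≤s small₂)) ⟩
      X * (suc X ^ s * (X * X ^ q) * 2 ^ M) + X * (suc X ^ s * X ^ q * 2 ^ M)
        ≡⟨ collect X (suc X ^ s) (X ^ q) (2 ^ M) ⟩
      suc X * suc X ^ s * (X * X ^ q) * 2 ^ M ∎
      where
      F₁ = xs ++ ys
      F₂ = filter (R? v) F₁
      F↭ : F ↭ v ∷ F₁
      F↭ = shift v xs ys
      1+F₁≡F : suc (length F₁) ≡ length F
      1+F₁≡F = sym (↭-length F↭)
      F₁≤s : length F₁ ≤ s
      F₁≤s = s≤s⁻¹ (≤-trans (≤-reflexive 1+F₁≡F) F≤s)
      F₂≤s : length F₂ ≤ s
      F₂≤s = ≤-trans (length-filter (R? v) F₁) F₁≤s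
      uF₁ : Unique F₁
      uF₁ with ↭ₛ.Unique-resp-↭ (setoid A) (↭⇒↭ₛ F↭) uF
      ... | _ ∷ u = u
      uF₂ : Unique F₂
      uF₂ = Unique.filter⁺ (R? v) uF₁
      small₁ : length F₁ * b ^ suc q < suc M * suc b ^ suc q
      small₁ = ≤-<-trans (*-monoˡ-≤ (b ^ suc q) (≤-trans (n≤1+n _) (≤-reflexive 1+F₁≡F))) small
      few₂ : suc b * length F₂ ≤ b * length F
      few₂ = subst (λ G → suc b * length G ≤ b * length F) (filter-self xs v ys) few
      -- Choosing `v` shrinks the family by the factor `b / (1 + b)`, which compensates exactly for
      -- the lost unit of `q`.
      small₂ : length F₂ * b ^ q < suc M * suc b ^ q
      small₂ = *-cancelˡ-< (suc b) _ _ (begin-strict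
        suc b * (length F₂ * b ^ q)   ≡⟨ *-assoc (suc b) (length F₂) (b ^ q) ⟨
        suc b * length F₂ * b ^ q     ≤⟨ *-monoˡ-≤ (b ^ q) few₂ ⟩
        b * length F * b ^ q          ≡⟨ regroup b (length F) (b ^ q) ⟩
        length F * b ^ suc q          <⟨ small ⟩
        suc M * suc b ^ suc q         ≡⟨ sym (swap₃ (suc b) (suc M) (suc b ^ q)) ⟩
        suc b * (suc M * suc b ^ q)   ∎)
        where
        regroup : ∀ x y z → x * y * z ≡ y * (x * z)
        regroup = solve-∀
        swap₃ : ∀ x y z → x * (y * z) ≡ y * (x * z)
        swap₃ = solve-∀
      distrib : ∀ a c x y → (a + c) * (x * y) ≡ x * (a * y) + x * (c * y)
      distrib = solve-∀
      collect : ∀ x y z w → x * (y * (x * z) * w) + x * (y * z * w) ≡ (1 + x) * y * (x * z) * w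
      collect = solve-∀

-- Sums and indicators

∑ : List A → (A → ℕ) → ℕ
∑ xs f = sum (map f xs)

𝟙 : {P : Set} → Dec P → ℕ
𝟙 P? = if does P? then 1 else 0

𝟙-mono : {P Q : Set} (P? : Dec P) (Q? : Dec Q) → (P → Q) → 𝟙 P? ≤ 𝟙 Q?
𝟙-mono (yes p) (yes _) _ = ≤-refl
𝟙-mono (yes p) (no ¬q) f = contradiction (f p) ¬q
𝟙-mono (no _)  _       _ = z≤n

𝟙-yes : {P : Set} (P? : Dec P) → P → 𝟙 P? ≡ 1
𝟙-yes (yes _) _ = refl
𝟙-yes (no ¬p) p = contradiction p ¬p

𝟙-no : {P : Set} (P? : Dec P) → ¬ P → 𝟙 P? ≡ 0
𝟙-no (yes p) ¬p = contradiction p ¬p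
𝟙-no (no _)  _  = refl

𝟙≤1 : {P : Set} (P? : Dec P) → 𝟙 P? ≤ 1
𝟙≤1 (yes _) = ≤-refl
𝟙≤1 (no _)  = z≤n

∑-++ : ∀ (xs ys : List A) f → ∑ (xs ++ ys) f ≡ ∑ xs f + ∑ ys f
∑-++ xs ys f = trans (cong sum (map-++ f xs ys)) (sum-++ (map f xs) (map f ys))

∑-map : ∀ (g : A → B) xs f → ∑ (map g xs) f ≡ ∑ xs (f ∘ g)
∑-map g xs f = cong sum (sym (map-∘ xs))

∑-mono : ∀ {f g : A → ℕ} → (∀ x → f x ≤ g x) → ∀ xs → ∑ xs f ≤ ∑ xs g
∑-mono f≤g []       = z≤n
∑-mono f≤g (x ∷ xs) = +-mono-≤ (f≤g x) (∑-mono f≤g xs)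

∑-cong : ∀ {f g : A → ℕ} → (∀ x → f x ≡ g x) → ∀ xs → ∑ xs f ≡ ∑ xs g
∑-cong f≡g []       = refl
∑-cong f≡g (x ∷ xs) = cong₂ _+_ (f≡g x) (∑-cong f≡g xs)

∑-bound : ∀ {f : A → ℕ} {c xs} → All (λ x → f x ≤ c) xs → ∑ xs f ≤ length xs * c
∑-bound []       = z≤n
∑-bound (p ∷ ps) = +-mono-≤ p (∑-bound ps)

∑-const : ∀ c (xs : List A) → ∑ xs (λ _ → c) ≡ length xs * c
∑-const c []       = refl
∑-const c (x ∷ xs) = cong (c +_) (∑-const c xs)

∑-+ : ∀ (f g : A → ℕ) xs → ∑ xs (λ x → f x + g x) ≡ ∑ xs f + ∑ xs g
∑-+ f g []       = refl
∑-+ f g (x ∷ xs) = trans (cong (f x + g x +_) (∑-+ f g xs)) (+-interchange (f x) (g x) _ _)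

∑-*ʳ : ∀ c (f : A → ℕ) xs → ∑ xs (λ x → f x * c) ≡ ∑ xs f * c
∑-*ʳ c f []       = refl
∑-*ʳ c f (x ∷ xs) = trans (cong (f x * c +_) (∑-*ʳ c f xs)) (sym (*-distribʳ-+ c (f x) _))

∑-*ˡ : ∀ c (f : A → ℕ) xs → ∑ xs (λ x → c * f x) ≡ c * ∑ xs f
∑-*ˡ c f xs = trans (∑-cong (λ x → *-comm c (f x)) xs) (trans (∑-*ʳ c f xs) (*-comm _ c))

∑-swap : ∀ (f : A → B → ℕ) xs ys → ∑ xs (λ x → ∑ ys (f x)) ≡ ∑ ys (λ y → ∑ xs (λ x → f x y))
∑-swap f []       ys = sym (trans (∑-const 0 ys) (*-zeroʳ (length ys)))
∑-swap f (x ∷ xs) ys = trans (cong (∑ ys (f x) +_) (∑-swap f xs ys)) (sym (∑-+ (f x) _ ys))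

-- Both sides grow by the same amount when `x` and `y` increase by one together, so the induction
-- ends at a zero argument and avoids subtraction.
2xy≤x²+y² : ∀ x y → 2 * (x * y) ≤ x * x + y * y
2xy≤x²+y² zero    y       = z≤n
2xy≤x²+y² (suc x) zero    = ≤-trans (≤-reflexive (cong (2 *_) (*-zeroʳ x))) z≤n
2xy≤x²+y² (suc x) (suc y) = begin
  2 * (suc x * suc y)                 ≡⟨ lhs x y ⟩
  2 * (x * y) + (2 + 2 * x + 2 * y)   ≤⟨ +-monoˡ-≤ _ (2xy≤x²+y² x y) ⟩
  x * x + y * y + (2 + 2 * x + 2 * y) ≡⟨ rhs x y ⟩
  suc x * suc x + suc y * suc y       ∎
  where
  open ≤-Reasoning
  lhs : ∀ x y → 2 * ((1 + x) * (1 + y)) ≡ 2 * (x * y) + (2 + 2 * x + 2 * y)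
  lhs = solve-∀
  rhs : ∀ x y → x * x + y * y + (2 + 2 * x + 2 * y) ≡ (1 + x) * (1 + x) + (1 + y) * (1 + y)
  rhs = solve-∀

-- Each new entry `a` creates the cross term `2 * (a * S)`, which is distributed over the earlier
-- summands and bounded one by one with `2xy≤x²+y²`.
cauchy-schwarz : ∀ (f : A → ℕ) xs → ∑ xs f * ∑ xs f ≤ length xs * ∑ xs (λ x → f x * f x)
cauchy-schwarz f []       = z≤n
cauchy-schwarz f (x ∷ xs) = begin
  (a + S) * (a + S)                ≡⟨ expand a S ⟩
  a * a + 2 * (a * S) + S * S      ≤⟨ +-mono-≤ (+-monoʳ-≤ (a * a) cross) (cauchy-schwarz f xs) ⟩
  a * a + (l * (a * a) + Q) + l * Q ≡⟨ collect (a * a) l Q ⟩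
  suc l * (a * a + Q)              ∎
  where
  open ≤-Reasoning
  a = f x
  S = ∑ xs f
  Q = ∑ xs (λ y → f y * f y)
  l = length xs
  expand : ∀ a S → (a + S) * (a + S) ≡ a * a + 2 * (a * S) + S * S
  expand = solve-∀
  collect : ∀ c l Q → c + (l * c + Q) + l * Q ≡ (1 + l) * (c + Q)
  collect = solve-∀
  cross : 2 * (a * S) ≤ l * (a * a) + Q
  cross = begin
    2 * (a * S)                          ≡⟨ *-assoc 2 a S ⟨
    2 * a * S                            ≡⟨ ∑-*ˡ (2 * a) f xs ⟨
    ∑ xs (λ y → 2 * a * f y)             ≤⟨ ∑-mono (λ y → ≤-trans (≤-reflexive (*-assoc 2 a (f y))) (2xy≤x²+y² a (f y))) xs ⟩
    ∑ xs (λ y → a * a + f y * f y)       ≡⟨ ∑-+ (λ _ → a * a) _ xs ⟩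
    ∑ xs (λ _ → a * a) + Q               ≡⟨ cong (_+ Q) (∑-const (a * a) xs) ⟩
    l * (a * a) + Q                      ∎

-- Hamming balls

-- V⁻ n t is V(n, t - 1).
V⁻ : ℕ → ℕ → ℕ
V⁻ n zero    = 0
V⁻ n (suc t) = V n t

V-zero : ∀ t → V 0 t ≡ 1
V-zero zero    = refl
V-zero (suc t) = trans (+-identityʳ _) (V-zero t)

-- Pascal's rule, summed over the layers of the ball.
V-suc : ∀ n t → V (suc n) t ≡ V n t + V⁻ n t
V-suc n zero          = refl
V-suc n (suc zero)    = cong suc (trans (sym (nCk+nC[k+1]≡[n+1]C[k+1] n 0)) (+-comm (n C 0) (n C 1)))
V-suc n (suc (suc t)) = begin
  V (suc n) (suc t) + suc n C suc (suc t)
    ≡⟨ cong₂ _+_ (V-suc n (suc t)) (sym (nCk+nC[k+1]≡[n+1]C[k+1] n (suc t))) ⟩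
  (V n (suc t) + V n t) + (n C suc t + n C suc (suc t))
    ≡⟨ interchange (V n (suc t)) (V n t) (n C suc t) (n C suc (suc t)) ⟩
  V n (suc (suc t)) + V n (suc t) ∎
  where
  open ≡-Reasoning
  interchange : ∀ a b c d → (a + b) + (c + d) ≡ (a + d) + (b + c)
  interchange = solve-∀

V>0 : ∀ n t → 0 < V n t
V>0 n zero    = ≤-refl
V>0 n (suc t) = ≤-trans (V>0 n t) (m≤m+n _ _)

-- The left side counts pairs of a set of size at most `t` in a ground set of size `1 + n` and one
-- of its elements; each set has at most `t` of them. The proof is by induction through `V-suc`.
-- This is the source of the saving `t / n`.
[1+n]V⁻≤tV : ∀ n t → suc n * V⁻ n t ≤ t * V (suc n) t
[1+n]V⁻≤tV n       zero    = ≤-reflexive (*-zeroʳ n)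
[1+n]V⁻≤tV zero    (suc t) = begin
  V 0 t + 0         ≡⟨ trans (+-identityʳ _) (V-zero t) ⟩
  1                 ≤⟨ *-mono-≤ {1} {suc t} (s≤s z≤n) (V>0 1 (suc t)) ⟩
  suc t * V 1 (suc t) ∎
  where open ≤-Reasoning
[1+n]V⁻≤tV (suc n) (suc t) = begin
  v + suc n * v                        ≡⟨ cong (λ z → v + suc n * z) (V-suc n t) ⟩
  v + suc n * (V n t + V⁻ n t)         ≡⟨ cong (v +_) (*-distribˡ-+ (suc n) (V n t) _) ⟩
  v + (suc n * V n t + suc n * V⁻ n t) ≤⟨ +-monoʳ-≤ v (+-mono-≤ ([1+n]V⁻≤tV n (suc t)) ([1+n]V⁻≤tV n t)) ⟩
  v + (suc t * w + t * v)              ≡⟨ collect v w t ⟩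
  suc t * (w + v)                      ≡⟨ cong (suc t *_) (V-suc (suc n) (suc t)) ⟨
  suc t * V (suc (suc n)) (suc t)      ∎
  where
  open ≤-Reasoning
  v = V (suc n) t
  w = V (suc n) (suc t)
  collect : ∀ v w t → v + ((1 + t) * w + t * v) ≡ (1 + t) * (w + v)
  collect = solve-∀

-- A set of at most `t` elements can be written as a word of length `t` over the ground set and a
-- blank. The bound is crude, but `V` enters the cost of the choices only through its logarithm.
V≤[1+n]^t : ∀ n t → V n t ≤ suc n ^ t
V≤[1+n]^t n       zero    = ≤-refl
V≤[1+n]^t zero    (suc t) = ≤-reflexive (trans (V-zero (suc t)) (sym (^-zeroˡ (suc t))))
V≤[1+n]^t (suc n) (suc t) = begin
  V (suc n) (suc t)               ≡⟨ V-suc n (suc t) ⟩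
  V n (suc t) + V n t             ≤⟨ +-mono-≤ (V≤[1+n]^t n (suc t)) (V≤[1+n]^t n t) ⟩
  suc n * suc n ^ t + suc n ^ t   ≡⟨ +-comm (suc n * suc n ^ t) _ ⟩
  suc (suc n) * suc n ^ t         ≤⟨ *-monoʳ-≤ (suc (suc n)) (^-monoˡ-≤ t (n≤1+n (suc n))) ⟩
  suc (suc n) ^ suc t             ∎
  where open ≤-Reasoning

length-allSubs : ∀ n → length (allSubs n) ≡ 2 ^ n
length-allSubs zero    = refl
length-allSubs (suc n) = trans (length-++ (map (false ∷_) (allSubs n)))
  (cong₂ _+_ (trans (length-map _ (allSubs n)) (length-allSubs n))
    (trans (trans (length-map _ (allSubs n)) (length-allSubs n)) (sym (+-identityʳ _))))

allSubs-unique : ∀ n → Unique (allSubs n)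
allSubs-unique zero    = [] ∷ []
allSubs-unique (suc n) = Unique.++⁺ (Unique.map⁺ (λ { refl → refl }) (allSubs-unique n))
  (Unique.map⁺ (λ { refl → refl }) (allSubs-unique n)) disjoint
  where
  disjoint : Disjoint (map (false ∷_) (allSubs n)) (map (true ∷_) (allSubs n))
  disjoint (v∈₁ , v∈₂) with ∈-map⁻ (false ∷_) v∈₁ | ∈-map⁻ (true ∷_) v∈₂
  ... | _ , _ , refl | _ , _ , ()

∑-allSubs-suc : ∀ n (f : Sub (suc n) → ℕ) →
  ∑ (allSubs (suc n)) f ≡ ∑ (allSubs n) (f ∘ (false ∷_)) + ∑ (allSubs n) (f ∘ (true ∷_))
∑-allSubs-suc n f = trans (∑-++ (map (false ∷_) (allSubs n)) _ f)
  (cong₂ _+_ (∑-map (false ∷_) (allSubs n) f) (∑-map (true ∷_) (allSubs n) f))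

dist-refl : ∀ {n} (x : Sub n) → dist x x ≡ 0
dist-refl []          = refl
dist-refl (false ∷ x) = dist-refl x
dist-refl (true ∷ x)  = dist-refl x

dist-sym : ∀ {n} (x y : Sub n) → dist x y ≡ dist y x
dist-sym []          []          = refl
dist-sym (false ∷ x) (false ∷ y) = dist-sym x y
dist-sym (false ∷ x) (true ∷ y)  = cong suc (dist-sym x y)
dist-sym (true ∷ x)  (false ∷ y) = cong suc (dist-sym x y)
dist-sym (true ∷ x)  (true ∷ y)  = dist-sym x y

dist-triangle : ∀ {n} (x y z : Sub n) → dist x y ≤ dist x z + dist y z
dist-triangle []          []          []          = z≤n
dist-triangle (false ∷ x) (false ∷ y) (false ∷ z) = dist-triangle x y z
dist-triangle (true ∷ x)  (true ∷ y)  (true ∷ z)  = dist-triangle x y z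
dist-triangle (false ∷ x) (false ∷ y) (true ∷ z)  = m≤n⇒m≤1+n (≤-trans (dist-triangle x y z) (+-monoʳ-≤ (dist x z) (n≤1+n _)))
dist-triangle (true ∷ x)  (true ∷ y)  (false ∷ z) = m≤n⇒m≤1+n (≤-trans (dist-triangle x y z) (+-monoʳ-≤ (dist x z) (n≤1+n _)))
dist-triangle (false ∷ x) (true ∷ y)  (false ∷ z) = ≤-trans (s≤s (dist-triangle x y z)) (≤-reflexive (sym (+-suc (dist x z) _)))
dist-triangle (true ∷ x)  (false ∷ y) (true ∷ z)  = ≤-trans (s≤s (dist-triangle x y z)) (≤-reflexive (sym (+-suc (dist x z) _)))
dist-triangle (false ∷ x) (true ∷ y)  (true ∷ z)  = s≤s (dist-triangle x y z)
dist-triangle (true ∷ x)  (false ∷ y) (false ∷ z) = s≤s (dist-triangle x y z)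

within : ∀ {n} → ℕ → Sub n → Sub n → ℕ
within t x y = 𝟙 (dist x y ≤? t)

𝟙-suc≤suc : ∀ m n → 𝟙 (suc m ≤? suc n) ≡ 𝟙 (m ≤? n)
𝟙-suc≤suc m n = ≤-antisym (𝟙-mono (suc m ≤? suc n) (m ≤? n) s≤s⁻¹) (𝟙-mono (m ≤? n) (suc m ≤? suc n) s≤s)

-- Points agreeing with `x` in the first coordinate have the full radius left for the others, the
-- remaining points one less; this is the recursion of `V-suc`.
∑-within : ∀ {n} t (x : Sub n) → ∑ (allSubs n) (within t x) ≡ V n t
-- Radius `t - 1` is written as `suc (dist x v) ≤ t`, which correctly gives the empty ball at
-- `t = 0`.
∑-within⁻ : ∀ {n} t (x : Sub n) → ∑ (allSubs n) (λ v → 𝟙 (suc (dist x v) ≤? t)) ≡ V⁻ n t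

∑-within⁻ {n} zero    x = trans (∑-const 0 (allSubs n)) (*-zeroʳ (length (allSubs n)))
∑-within⁻ {n} (suc t) x = trans (∑-cong (λ v → 𝟙-suc≤suc (dist x v) t) (allSubs n)) (∑-within t x)

∑-within {zero} t []      = sym (V-zero t)
∑-within {suc n} t (false ∷ x) = trans (∑-allSubs-suc n _)
  (trans (cong₂ _+_ (∑-within t x) (∑-within⁻ t x)) (sym (V-suc n t)))
∑-within {suc n} t (true ∷ x) = trans (∑-allSubs-suc n _)
  (trans (cong₂ _+_ (∑-within⁻ t x) (∑-within t x)) (trans (+-comm (V⁻ n t) _) (sym (V-suc n t))))

-- Intersections of two balls

common : ∀ {n} → ℕ → Sub n → Sub n → ℕ
common {n} t x y = ∑ (allSubs n) (λ v → within t x v * within t y v)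

common⁻ : ∀ {n} → ℕ → Sub n → Sub n → ℕ
common⁻ {n} t x y = ∑ (allSubs n) (λ v → 𝟙 (suc (dist x v) ≤? t) * 𝟙 (suc (dist y v) ≤? t))

*𝟙≤ : {P : Set} (m : ℕ) (P? : Dec P) → m * 𝟙 P? ≤ m
*𝟙≤ m P? = ≤-trans (*-monoʳ-≤ m (𝟙≤1 P?)) (≤-reflexive (*-identityʳ m))

common-≤V : ∀ {n} t (x y : Sub n) → common t x y ≤ V n t
common-≤V {n} t x y = ≤-trans (∑-mono (λ v → *𝟙≤ _ (dist y v ≤? t)) (allSubs n)) (≤-reflexive (∑-within t x))

-- Distinct x and y differ in some coordinate, in which every point differs from x or from y.
common-≢ : ∀ {n} t (x y : Sub (suc n)) → x ≢ y → common t x y ≤ 2 * V⁻ n t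
-- The left side is what `common t` becomes after a common first coordinate is prepended to `x` and
-- `y`: points sharing that coordinate keep radius `t`, the others have `t - 1`. The two lemmas thus
-- recurse through each other until `x` and `y` differ.
common⁻-≢ : ∀ {n} t (x y : Sub n) → x ≢ y → common t x y + common⁻ t x y ≤ 2 * V⁻ n t

common⁻-≢ {zero}  t []   []   x≢y = contradiction refl x≢y
common⁻-≢ {suc n} zero x y x≢y = begin
  common 0 x y + common⁻ 0 x y ≡⟨ cong (common 0 x y +_) (trans (∑-const 0 (allSubs (suc n))) (*-zeroʳ (length (allSubs (suc n))))) ⟩
  common 0 x y + 0             ≡⟨ +-identityʳ _ ⟩
  common 0 x y                 ≤⟨ common-≢ 0 x y x≢y ⟩
  0                            ∎
  where open ≤-Reasoning
common⁻-≢ {suc n} (suc t) x y x≢y = begin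
  common (suc t) x y + common⁻ (suc t) x y
    ≡⟨ cong (common (suc t) x y +_) (∑-cong (λ v → cong₂ _*_ (𝟙-suc≤suc (dist x v) t) (𝟙-suc≤suc (dist y v) t)) (allSubs (suc n))) ⟩
  common (suc t) x y + common t x y ≤⟨ +-mono-≤ (common-≢ (suc t) x y x≢y) (common-≢ t x y x≢y) ⟩
  2 * V n t + 2 * V⁻ n t            ≡⟨ *-distribˡ-+ 2 (V n t) (V⁻ n t) ⟨
  2 * (V n t + V⁻ n t)              ≡⟨ cong (2 *_) (V-suc n t) ⟨
  2 * V (suc n) t                   ∎
  where open ≤-Reasoning

common-≢ {n} t (false ∷ x) (false ∷ y) x≢y = ≤-trans (≤-reflexive (∑-allSubs-suc n _))
  (common⁻-≢ t x y (x≢y ∘ cong (false ∷_)))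
common-≢ {n} t (true ∷ x) (true ∷ y) x≢y = ≤-trans (≤-reflexive (trans (∑-allSubs-suc n _) (+-comm (common⁻ t x y) _)))
  (common⁻-≢ t x y (x≢y ∘ cong (true ∷_)))
common-≢ {n} t (false ∷ x) (true ∷ y) x≢y = ≤-trans (≤-reflexive (∑-allSubs-suc n _)) (begin
  _ ≤⟨ +-mono-≤ (∑-mono (λ v → ≤-trans (≤-reflexive (*-comm (within t x v) _)) (*𝟙≤ _ (dist x v ≤? t))) (allSubs n))
                (∑-mono (λ v → *𝟙≤ _ (dist y v ≤? t)) (allSubs n)) ⟩
  _ ≡⟨ cong₂ _+_ (∑-within⁻ t y) (trans (∑-within⁻ t x) (sym (+-identityʳ _))) ⟩
  2 * V⁻ n t ∎)
  where open ≤-Reasoning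
common-≢ {n} t (true ∷ x) (false ∷ y) x≢y = ≤-trans (≤-reflexive (∑-allSubs-suc n _)) (begin
  _ ≤⟨ +-mono-≤ (∑-mono (λ v → *𝟙≤ _ (dist y v ≤? t)) (allSubs n))
                (∑-mono (λ v → ≤-trans (≤-reflexive (*-comm (within t x v) _)) (*𝟙≤ _ (dist x v ≤? t))) (allSubs n)) ⟩
  _ ≡⟨ cong₂ _+_ (∑-within⁻ t x) (trans (∑-within⁻ t y) (sym (+-identityʳ _))) ⟩
  2 * V⁻ n t ∎)
  where open ≤-Reasoning

common-far : ∀ {n} t (x y : Sub n) → ¬ dist x y ≤ 2 * t → common t x y ≡ 0
common-far {n} t x y far = trans (∑-cong disjoint (allSubs n)) (trans (∑-const 0 (allSubs n)) (*-zeroʳ (length (allSubs n))))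
  where
  disjoint : ∀ v → within t x v * within t y v ≡ 0
  disjoint v with dist x v ≤? t | dist y v ≤? t
  ... | no p  | _     = cong (_* within t y v) (𝟙-no (dist x v ≤? t) p)
  ... | yes _ | no q  = trans (cong (within t x v *_) (𝟙-no (dist y v ≤? t) q)) (*-zeroʳ (within t x v))
  ... | yes p | yes q = contradiction (≤-trans (dist-triangle x y v)
          (≤-trans (+-mono-≤ p q) (≤-reflexive (cong (t +_) (sym (+-identityʳ t)))))) far

_≟ˢ_ : ∀ {n} (x y : Sub n) → Dec (x ≡ y)
_≟ˢ_ = ≡-dec Bool._≟_

-- Joins the equal, close and far cases by indicators, so that summing over `y` yields one diagonal
-- term and a multiple of the degree of `x`.
common-bound : ∀ {n} t (x y : Sub (suc n)) →
  common t x y ≤ 𝟙 (x ≟ˢ y) * V (suc n) t + within (2 * t) x y * (2 * V⁻ n t)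
common-bound {n} t x y with x ≟ˢ y | dist x y ≤? 2 * t
... | yes _  | _      = ≤-trans (≤-trans (common-≤V t x y) (≤-reflexive (sym (+-identityʳ _)))) (m≤m+n _ _)
... | no _   | no far = ≤-trans (≤-reflexive (common-far t x y far)) z≤n
... | no x≢y | yes near = begin
  common t x y                          ≤⟨ common-≢ t x y x≢y ⟩
  2 * V⁻ n t                            ≡⟨ *-identityˡ _ ⟨
  1 * (2 * V⁻ n t)                      ≡⟨ cong (_* (2 * V⁻ n t)) (𝟙-yes (dist x y ≤? 2 * t) near) ⟨
  within (2 * t) x y * (2 * V⁻ n t)     ∎
  where open ≤-Reasoning

-- Supersaturation

∑-𝟙≡≤1 : ∀ {n} (x : Sub n) {F} → Unique F → ∑ F (λ y → 𝟙 (x ≟ˢ y)) ≤ 1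
∑-𝟙≡≤1 x []                = z≤n
∑-𝟙≡≤1 x (_∷_ {x = y} {xs = F} y∉F uF) with x ≟ˢ y
... | no _     = ∑-𝟙≡≤1 x uF
... | yes refl = s≤s (≤-trans (∑-bound (All.map (λ {z} x≢z → ≤-reflexive (𝟙-no (x ≟ˢ z) x≢z)) y∉F))
                   (≤-reflexive (*-zeroʳ (length F))))

-- A member `x` of `F` counts itself, so the degree is exactly complementary to the number of
-- members far from `x`.
degree : ∀ {n} → ℕ → List (Sub n) → Sub n → ℕ
degree t F x = ∑ F (within (2 * t) x)

module _ {n} (t : ℕ) (F : List (Sub (suc n))) where
  private
    Ω = allSubs (suc n)
    v = V (suc n) t
    w = 2 * V⁻ n t
    l = length F

  multiplicity : Sub (suc n) → ℕ
  multiplicity z = ∑ F (λ x → within t x z)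

  ∑-multiplicity : ∑ Ω multiplicity ≡ l * v
  ∑-multiplicity = trans (sym (∑-swap (within t) F Ω))
    (trans (∑-cong (∑-within t) F) (∑-const v F))

  -- The square counts ordered pairs of members whose balls both contain `z`; exchanging the sums
  -- counts the common points of each pair.
  ∑-multiplicity² : ∑ Ω (λ z → multiplicity z * multiplicity z) ≡ ∑ F (λ x → ∑ F (common t x))
  ∑-multiplicity² = begin
    ∑ Ω (λ z → multiplicity z * multiplicity z)
      ≡⟨ ∑-cong (λ z → trans (sym (∑-*ʳ (multiplicity z) _ F)) (∑-cong (λ x → sym (∑-*ˡ (within t x z) _ F)) F)) Ω ⟩
    ∑ Ω (λ z → ∑ F (λ x → ∑ F (λ y → within t x z * within t y z)))
      ≡⟨ ∑-swap _ F Ω ⟨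
    ∑ F (λ x → ∑ Ω (λ z → ∑ F (λ y → within t x z * within t y z)))
      ≡⟨ ∑-cong (λ x → sym (∑-swap (λ y z → within t x z * within t y z) F Ω)) F ⟩
    ∑ F (λ x → ∑ F (common t x)) ∎
    where open ≡-Reasoning

  ∑-common : Unique F → ∀ x → ∑ F (common t x) ≤ v + degree t F x * w
  ∑-common uF x = begin
    ∑ F (common t x)
      ≤⟨ ∑-mono (common-bound t x) F ⟩
    ∑ F (λ y → 𝟙 (x ≟ˢ y) * v + within (2 * t) x y * w)
      ≡⟨ ∑-+ (λ y → 𝟙 (x ≟ˢ y) * v) _ F ⟩
    ∑ F (λ y → 𝟙 (x ≟ˢ y) * v) + ∑ F (λ y → within (2 * t) x y * w)
      ≡⟨ cong₂ _+_ (∑-*ʳ v _ F) (∑-*ʳ w _ F) ⟩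
    ∑ F (λ y → 𝟙 (x ≟ˢ y)) * v + degree t F x * w
      ≤⟨ +-monoˡ-≤ _ (*-monoˡ-≤ v (∑-𝟙≡≤1 x uF)) ⟩
    1 * v + degree t F x * w
      ≡⟨ cong (_+ degree t F x * w) (*-identityˡ v) ⟩
    v + degree t F x * w ∎
    where open ≤-Reasoning

  -- Low degrees force few coincidences among the balls, while Cauchy-Schwarz over all centres
  -- forces many. The factor `b` is carried along to avoid dividing by it.
  supersaturation : ∀ b → Unique F → All (λ x → b * degree t F x ≤ l) F →
    b * (l * v * (l * v)) ≤ 2 ^ suc n * (b * (l * v) + l * l * w)
  supersaturation b uF low = begin
    b * (l * v * (l * v))
      ≡⟨ cong (b *_) (cong₂ _*_ ∑-multiplicity ∑-multiplicity) ⟨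
    b * (∑ Ω multiplicity * ∑ Ω multiplicity)
      ≤⟨ *-monoʳ-≤ b (cauchy-schwarz multiplicity Ω) ⟩
    b * (length Ω * ∑ Ω (λ z → multiplicity z * multiplicity z))
      ≡⟨ cong₂ (λ p q → b * (p * q)) (length-allSubs (suc n)) ∑-multiplicity² ⟩
    b * (N * ∑ F (λ x → ∑ F (common t x)))
      ≤⟨ *-monoʳ-≤ b (*-monoʳ-≤ N (∑-mono (∑-common uF) F)) ⟩
    b * (N * ∑ F (λ x → v + degree t F x * w))
      ≡⟨ cong (λ z → b * (N * z)) (trans (∑-+ (λ _ → v) _ F) (cong₂ _+_ (∑-const v F) (∑-*ʳ w _ F))) ⟩
    b * (N * (l * v + ∑ F (degree t F) * w))
      ≡⟨ regroup b N (l * v) (∑ F (degree t F)) w ⟩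
    N * (b * (l * v) + b * ∑ F (degree t F) * w)
      ≡⟨ cong (λ z → N * (b * (l * v) + z * w)) (∑-*ˡ b (degree t F) F) ⟨
    N * (b * (l * v) + ∑ F (λ x → b * degree t F x) * w)
      ≤⟨ *-monoʳ-≤ N (+-monoʳ-≤ (b * (l * v)) (*-monoˡ-≤ w (∑-bound low))) ⟩
    N * (b * (l * v) + l * l * w) ∎
    where
    open ≤-Reasoning
    N = 2 ^ suc n
    regroup : ∀ b N p d w → b * (N * (p + d * w)) ≡ N * (b * p + b * d * w)
    regroup = solve-∀

-- Vertices of high degree

-- Cancelling `l * v` from `low` leaves `reduced`. Of its left side, the first term on the right is
-- strictly less than the share `3k / (3k + 1)`, by `large`, and the second at most the share
-- `1 / (3k + 1)`, by `many`. The 8 in `many` arises as 2 times 4, from `3k + 1 ≤ 4k`.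
low-degree-absurd : ∀ N k t n b v l w .{{_ : NonZero n}} .{{_ : NonZero b}} .{{_ : NonZero v}} .{{_ : NonZero l}} →
  1 ≤ k → N * (3 * k + 1) < l * (3 * k * v) → 8 * t * k * N ≤ b * (n * v) → n * w ≤ t * v * 2 →
  ¬ b * (l * v * (l * v)) ≤ N * (b * (l * v) + l * l * w)
low-degree-absurd N k t n b v l w 1≤k large many nw≤2tv low =
  <-irrefl refl (begin-strict
    (3 * k + 1) * (n * b * (l * v))
      ≤⟨ *-monoʳ-≤ (3 * k + 1) reduced ⟩
    (3 * k + 1) * (N * (n * b + 2 * t * l))
      ≡⟨ split N k t n b l ⟩
    N * (3 * k + 1) * (n * b) + 2 * t * (3 * k + 1) * N * l
      <⟨ +-mono-<-≤ (*-monoˡ-< (n * b) {{m*n≢0 n b}} large)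
           (*-monoˡ-≤ l (*-monoˡ-≤ N (*-monoʳ-≤ (2 * t) (+-monoʳ-≤ (3 * k) 1≤k)))) ⟩
    l * (3 * k * v) * (n * b) + 2 * t * (3 * k + k) * N * l
      ≡⟨ cong (λ z → l * (3 * k * v) * (n * b) + z) (eight t k N l) ⟩
    l * (3 * k * v) * (n * b) + 8 * t * k * N * l
      ≤⟨ +-monoʳ-≤ (l * (3 * k * v) * (n * b)) (*-monoˡ-≤ l many) ⟩
    l * (3 * k * v) * (n * b) + b * (n * v) * l
      ≡⟨ collect k n b v l ⟩
    (3 * k + 1) * (n * b * (l * v)) ∎)
  where
  open ≤-Reasoning
  split : ∀ N k t n b l → (3 * k + 1) * (N * (n * b + 2 * t * l)) ≡ N * (3 * k + 1) * (n * b) + 2 * t * (3 * k + 1) * N * l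
  split = solve-∀
  eight : ∀ t k N l → 2 * t * (3 * k + k) * N * l ≡ 8 * t * k * N * l
  eight = solve-∀
  collect : ∀ k n b v l → l * (3 * k * v) * (n * b) + b * (n * v) * l ≡ (3 * k + 1) * (n * b * (l * v))
  collect = solve-∀
  assemble : ∀ n b l v → n * b * (l * v) * (l * v) ≡ n * (b * (l * v * (l * v)))
  assemble = solve-∀
  distribute : ∀ n N b l v w → n * (N * (b * (l * v) + l * l * w)) ≡ N * (n * b * (l * v) + l * l * (n * w))
  distribute = solve-∀
  factor : ∀ n N b l v t → N * (n * b * (l * v) + l * l * (t * v * 2)) ≡ N * (n * b + 2 * t * l) * (l * v)
  factor = solve-∀
  reduced : n * b * (l * v) ≤ N * (n * b + 2 * t * l)
  reduced = *-cancelʳ-≤ _ _ (l * v) {{m*n≢0 l v}} (begin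
    n * b * (l * v) * (l * v)                 ≡⟨ assemble n b l v ⟩
    n * (b * (l * v * (l * v)))               ≤⟨ *-monoʳ-≤ n low ⟩
    n * (N * (b * (l * v) + l * l * w))       ≡⟨ distribute n N b l v w ⟩
    N * (n * b * (l * v) + l * l * (n * w))   ≤⟨ *-monoʳ-≤ N (+-monoʳ-≤ (n * b * (l * v)) (*-monoʳ-≤ (l * l) nw≤2tv)) ⟩
    N * (n * b * (l * v) + l * l * (t * v * 2)) ≡⟨ factor n N b l v t ⟩
    N * (n * b + 2 * t * l) * (l * v)         ∎)

far? : ∀ {n} t (x y : Sub n) → Dec (2 * t + 1 ≤ dist x y)
far? t x y = 2 * t + 1 ≤? dist x y

length-filter+∑𝟙 : ∀ {A : Set} {P Q : A → Set} (P? : Decidable P) (Q? : Decidable Q) →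
  (∀ {x} → P x → ¬ Q x) → (∀ {x} → ¬ P x → Q x) →
  ∀ xs → length (filter P? xs) + ∑ xs (𝟙 ∘ Q?) ≡ length xs
length-filter+∑𝟙 P? Q? P⇒¬Q ¬P⇒Q [] = refl
length-filter+∑𝟙 P? Q? P⇒¬Q ¬P⇒Q (x ∷ xs) with P? x | Q? x
... | yes p | yes q = contradiction q (P⇒¬Q p)
... | yes _ | no _  = cong suc (length-filter+∑𝟙 P? Q? P⇒¬Q ¬P⇒Q xs)
... | no _  | yes _ = trans (+-suc _ _) (cong suc (length-filter+∑𝟙 P? Q? P⇒¬Q ¬P⇒Q xs))
... | no ¬p | no ¬q = contradiction (¬P⇒Q ¬p) ¬q

far+degree : ∀ {n} t (x : Sub n) F → length (filter (far? t x) F) + degree t F x ≡ length F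
far+degree t x = length-filter+∑𝟙 (far? t x) (λ y → dist x y ≤? 2 * t)
  (λ {y} far → <⇒≱ (subst (_≤ dist x y) (+-comm (2 * t) 1) far))
  (λ {y} ¬far → s≤s⁻¹ (subst (dist x y <_) (+-comm (2 * t) 1) (≰⇒> ¬far)))

-- Supplies `pick` for the algorithm: if no member had degree at least `length F / (1 + b)`,
-- supersaturation would contradict the size of `F`.
high-degree-vertex : ∀ {n} t k b M → 1 ≤ k →
  2 ^ suc n * (3 * k + 1) < suc M * (3 * k * V (suc n) t) →
  8 * t * k * 2 ^ suc n ≤ suc b * (suc n * V (suc n) t) →
  (F : List (Sub (suc n))) → Unique F → M < length F →
  ∃ λ x → x ∈ F × suc b * length (filter (far? t x) F) ≤ b * length F
high-degree-vertex {n} t k b M 1≤k large many F uF M<F with any? (λ x → length F ≤? suc b * degree t F x) F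
... | no none = contradiction
  (supersaturation t F (suc b) uF (All.map (<⇒≤ ∘ ≰⇒>) (¬Any⇒All¬ F none)))
  (low-degree-absurd (2 ^ suc n) k t (suc n) (suc b) (V (suc n) t) (length F) (2 * V⁻ n t)
    {{_}} {{_}} {{>-nonZero (V>0 (suc n) t)}} {{>-nonZero (≤-<-trans z≤n M<F)}} 1≤k
    (<-≤-trans large (*-monoˡ-≤ (3 * k * V (suc n) t) M<F)) many nw≤)
  where
  nw≤ : suc n * (2 * V⁻ n t) ≤ t * V (suc n) t * 2
  nw≤ = begin
    suc n * (2 * V⁻ n t)   ≡⟨ cong (suc n *_) (*-comm 2 (V⁻ n t)) ⟩
    suc n * (V⁻ n t * 2)   ≡⟨ *-assoc (suc n) (V⁻ n t) 2 ⟨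
    suc n * V⁻ n t * 2     ≤⟨ *-monoˡ-≤ 2 ([1+n]V⁻≤tV n t) ⟩
    t * V (suc n) t * 2    ∎
    where open ≤-Reasoning
... | yes some with find some
-- Adding `length F` to both sides turns the complement relation `far+degree` into an equation
-- without subtraction.
...   | x , x∈F , high = x , x∈F , +-cancelˡ-≤ (length F) _ _ (begin
  length F + suc b * f                ≤⟨ +-monoˡ-≤ (suc b * f) high ⟩
  suc b * degree t F x + suc b * f    ≡⟨ +-comm (suc b * degree t F x) _ ⟩
  suc b * f + suc b * degree t F x    ≡⟨ *-distribˡ-+ (suc b) f _ ⟨
  suc b * (f + degree t F x)          ≡⟨ cong (suc b *_) (far+degree t x F) ⟩
  length F + b * length F             ∎)
  where
  open ≤-Reasoning
  f = length (filter (far? t x) F)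

-- Exponential estimates

^-distribʳ-* : ∀ m n o → (m * n) ^ o ≡ m ^ o * n ^ o
^-distribʳ-* m n zero    = refl
^-distribʳ-* m n (suc o) = trans (cong (m * n *_) (^-distribʳ-* m n o)) (interchange m n (m ^ o) (n ^ o))
  where
  interchange : ∀ a b c d → a * b * (c * d) ≡ a * c * (b * d)
  interchange = solve-∀

^-cancelʳ-≤ : ∀ m n o .{{_ : NonZero o}} → m ^ o ≤ n ^ o → m ≤ n
^-cancelʳ-≤ m n o m^o≤n^o = ≮⇒≥ (λ n<m → <⇒≱ (^-monoˡ-< o n<m) m^o≤n^o)

m<2^m : ∀ m → m < 2 ^ m
m<2^m zero    = s≤s z≤n
m<2^m (suc m) = begin-strict
  suc m           ≤⟨ m<2^m m ⟩
  2 ^ m           <⟨ m<m+n (2 ^ m) (m^n>0 2 m) ⟩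
  2 ^ m + 2 ^ m   ≡⟨ cong (2 ^ m +_) (+-identityʳ (2 ^ m)) ⟨
  2 ^ suc m       ∎
  where open ≤-Reasoning

n<2^[1+⌊log₂n⌋] : ∀ n → n < 2 ^ suc ⌊log₂ n ⌋
n<2^[1+⌊log₂n⌋] n = ≰⇒> λ 2^≤n → <-irrefl refl
  (subst (_≤ ⌊log₂ n ⌋) (⌊log₂[2^n]⌋≡n (suc ⌊log₂ n ⌋)) (⌊log₂⌋-mono-≤ 2^≤n))

bernoulli : ∀ a m → a ^ m * (a + m) ≤ suc a ^ m * a
bernoulli a zero    = ≤-reflexive (cong (1 *_) (+-identityʳ a))
bernoulli a (suc m) = begin
  a * a ^ m * (a + suc m)                ≤⟨ m≤m+n _ (a ^ m * m) ⟩
  a * a ^ m * (a + suc m) + a ^ m * m    ≡⟨ expand a (a ^ m) m ⟩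
  suc a * (a ^ m * (a + m))              ≤⟨ *-monoʳ-≤ (suc a) (bernoulli a m) ⟩
  suc a * (suc a ^ m * a)                ≡⟨ *-assoc (suc a) (suc a ^ m) a ⟨
  suc a * suc a ^ m * a                  ∎
  where
  open ≤-Reasoning
  expand : ∀ a p m → a * p * (a + (1 + m)) + p * m ≡ (1 + a) * (p * (a + m))
  expand = solve-∀

-- Bernoulli with exponent `1 + a`: that many shrinkings by the factor `a / (1 + a)` at least halve
-- a quantity.
2*a^[1+a]≤[1+a]^[1+a] : ∀ a → 2 * a ^ suc a ≤ suc a ^ suc a
2*a^[1+a]≤[1+a]^[1+a] zero        = z≤n
2*a^[1+a]≤[1+a]^[1+a] a@(suc _) = *-cancelʳ-≤ _ _ a (begin
  2 * a ^ suc a * a         ≡⟨ double (a ^ suc a) a ⟩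
  a ^ suc a * (a + a)       ≤⟨ *-monoʳ-≤ (a ^ suc a) (+-monoʳ-≤ a (n≤1+n a)) ⟩
  a ^ suc a * (a + suc a)   ≤⟨ bernoulli a (suc a) ⟩
  suc a ^ suc a * a         ∎)
  where
  open ≤-Reasoning
  double : ∀ p a → 2 * p * a ≡ p * (a + a)
  double = solve-∀

2^L*a^[1+a]L≤[1+a]^[1+a]L : ∀ a L → 2 ^ L * a ^ (suc a * L) ≤ suc a ^ (suc a * L)
2^L*a^[1+a]L≤[1+a]^[1+a]L a L = begin
  2 ^ L * a ^ (suc a * L)     ≡⟨ cong (2 ^ L *_) (^-*-assoc a (suc a) L) ⟨
  2 ^ L * (a ^ suc a) ^ L     ≡⟨ ^-distribʳ-* 2 (a ^ suc a) L ⟨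
  (2 * a ^ suc a) ^ L         ≤⟨ ^-monoˡ-≤ L (2*a^[1+a]≤[1+a]^[1+a] a) ⟩
  (suc a ^ suc a) ^ L         ≡⟨ ^-*-assoc (suc a) (suc a) L ⟩
  suc a ^ (suc a * L)         ∎
  where open ≤-Reasoning

-- (1 + 1/x)^y ≤ 1 / (1 - y/x), with d = x - y.
[1+x]^y*d≤x^y*x : ∀ y d → suc (y + d) ^ y * d ≤ (y + d) ^ y * (y + d)
[1+x]^y*d≤x^y*x y d = go y d (y + d) refl
  where
  open ≤-Reasoning
  shuffle : ∀ x y d → (1 + x) * y * d ≡ y * ((1 + x) * d)
  shuffle = solve-∀
  raise : ∀ x y d → y * (x * d) ≡ x * (y * d)
  raise = solve-∀
  go : ∀ y d x → y + d ≡ x → suc x ^ y * d ≤ x ^ y * x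
  go zero    d x refl = ≤-refl
  go (suc y) d x refl = begin
    suc x * suc x ^ y * d       ≡⟨ shuffle x (suc x ^ y) d ⟩
    suc x ^ y * (suc x * d)     ≤⟨ *-monoʳ-≤ (suc x ^ y) (begin
        d + x * d                 ≤⟨ +-monoˡ-≤ (x * d) (m≤n⇒m≤o+n (suc y) ≤-refl) ⟩
        x + x * d                 ≡⟨ *-suc x d ⟨
        x * suc d                 ∎) ⟩
    suc x ^ y * (x * suc d)     ≡⟨ raise x (suc x ^ y) (suc d) ⟩
    x * (suc x ^ y * suc d)     ≤⟨ *-monoʳ-≤ x (go y (suc d) x (+-suc y d)) ⟩
    x * (x ^ y * x)             ≡⟨ *-assoc x (x ^ y) x ⟨
    x * x ^ y * x               ∎

-- The case `d = y` of the previous bound, where `1 - y/x` is one half. It motivates the weight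
-- `X = y + y`.
[1+2y]^y≤2*[2y]^y : ∀ y .{{_ : NonZero y}} → suc (y + y) ^ y ≤ 2 * (y + y) ^ y
[1+2y]^y≤2*[2y]^y y = *-cancelʳ-≤ _ _ y (≤-trans ([1+x]^y*d≤x^y*x y y) (≤-reflexive (double ((y + y) ^ y) y)))
  where
  double : ∀ p y → p * (y + y) ≡ 2 * p * y
  double = solve-∀

-- After raising to the power `y`, the three factors of the container bound cost `N`, `N` and
-- `N * (3 * k + 1)` bits, altogether `3 * N * (k + 1)`. The 3 in `y` lets each of the three error
-- terms take a third of the permitted `1/k`, and a final cube root removes it.
extract-bound : ∀ J N k v q x M .{{_ : NonZero k}} .{{_ : NonZero v}} →
  let y = 3 * k * v; X = y + y in
  J * X ^ N ≤ suc X ^ N * X ^ q * 2 ^ M → X ≤ 2 ^ x → x * (q * y) ≤ N → M * y ≤ N * (3 * k + 1) →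
  J ^ (k * v) ≤ 2 ^ (N * (k + 1))
extract-bound J N k v q x M bound X≤2^x xqy≤N My≤ = ^-cancelʳ-≤ _ _ 3 (begin
  (J ^ (k * v)) ^ 3         ≡⟨ ^-*-assoc J (k * v) 3 ⟩
  J ^ (k * v * 3)           ≡⟨ cong (J ^_) (rotate k v) ⟩
  J ^ y                     ≤⟨ *-cancelʳ-≤ _ _ (X ^ (N * y)) {{m^n≢0 X (N * y)}} powered ⟩
  2 ^ (N + (N + N * (3 * k + 1))) ≡⟨ cong (2 ^_) (total N k) ⟩
  2 ^ (N * (k + 1) * 3)     ≡⟨ ^-*-assoc 2 (N * (k + 1)) 3 ⟨
  (2 ^ (N * (k + 1))) ^ 3   ∎)
  where
  open ≤-Reasoning
  y = 3 * k * v
  X = y + y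
  instance
    y≢0 : NonZero y
    y≢0 = m*n≢0 (3 * k) v {{m*n≢0 3 k}}
    X≢0 : NonZero X
    X≢0 = >-nonZero (≤-trans (>-nonZero⁻¹ y) (m≤m+n y y))
  rotate : ∀ k v → k * v * 3 ≡ 3 * k * v
  rotate = solve-∀
  total : ∀ N k → N + (N + N * (3 * k + 1)) ≡ N * (k + 1) * 3
  total = solve-∀
  first : (suc X ^ N) ^ y ≤ 2 ^ N * X ^ (N * y)
  first = begin
    (suc X ^ N) ^ y       ≡⟨ trans (^-*-assoc (suc X) N y) (trans (cong (suc X ^_) (*-comm N y)) (sym (^-*-assoc (suc X) y N))) ⟩
    (suc X ^ y) ^ N       ≤⟨ ^-monoˡ-≤ N ([1+2y]^y≤2*[2y]^y y) ⟩
    (2 * X ^ y) ^ N       ≡⟨ ^-distribʳ-* 2 (X ^ y) N ⟩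
    2 ^ N * (X ^ y) ^ N   ≡⟨ cong (2 ^ N *_) (trans (^-*-assoc X y N) (cong (X ^_) (*-comm y N))) ⟩
    2 ^ N * X ^ (N * y)   ∎
  second : (X ^ q) ^ y ≤ 2 ^ N
  second = begin
    (X ^ q) ^ y           ≡⟨ ^-*-assoc X q y ⟩
    X ^ (q * y)           ≤⟨ ^-monoˡ-≤ (q * y) X≤2^x ⟩
    (2 ^ x) ^ (q * y)     ≡⟨ ^-*-assoc 2 x (q * y) ⟩
    2 ^ (x * (q * y))     ≤⟨ ^-monoʳ-≤ 2 xqy≤N ⟩
    2 ^ N                 ∎
  third : (2 ^ M) ^ y ≤ 2 ^ (N * (3 * k + 1))
  third = ≤-trans (≤-reflexive (^-*-assoc 2 M y)) (^-monoʳ-≤ 2 My≤)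
  regroup : ∀ a p c d → a * p * c * d ≡ a * (c * d) * p
  regroup = solve-∀
  powered : J ^ y * X ^ (N * y) ≤ 2 ^ (N + (N + N * (3 * k + 1))) * X ^ (N * y)
  powered = begin
    J ^ y * X ^ (N * y)                             ≡⟨ cong (J ^ y *_) (^-*-assoc X N y) ⟨
    J ^ y * (X ^ N) ^ y                             ≡⟨ ^-distribʳ-* J (X ^ N) y ⟨
    (J * X ^ N) ^ y                                 ≤⟨ ^-monoˡ-≤ y bound ⟩
    (suc X ^ N * X ^ q * 2 ^ M) ^ y                 ≡⟨ trans (^-distribʳ-* (suc X ^ N * X ^ q) (2 ^ M) y)
                                                         (cong (_* (2 ^ M) ^ y) (^-distribʳ-* (suc X ^ N) (X ^ q) y)) ⟩
    (suc X ^ N) ^ y * (X ^ q) ^ y * (2 ^ M) ^ y     ≤⟨ *-mono-≤ (*-mono-≤ first second) third ⟩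
    2 ^ N * X ^ (N * y) * 2 ^ N * 2 ^ (N * (3 * k + 1))
      ≡⟨ regroup (2 ^ N) (X ^ (N * y)) (2 ^ N) _ ⟩
    2 ^ N * (2 ^ N * 2 ^ (N * (3 * k + 1))) * X ^ (N * y)
      ≡⟨ cong (_* X ^ (N * y)) (trans (^-distribˡ-+-* 2 N _) (cong (2 ^ N *_) (^-distribˡ-+-* 2 N _))) ⟨
    2 ^ (N + (N + N * (3 * k + 1))) * X ^ (N * y)   ∎

-- Choice of the parameters

m<[1+m/n]*n : ∀ m n .{{_ : NonZero n}} → m < suc (m / n) * n
m<[1+m/n]*n m n = begin-strict
  m                     ≡⟨ m≡m%n+[m/n]*n m n ⟩
  m % n + m / n * n     <⟨ +-monoˡ-< (m / n * n) (m%n<n m n) ⟩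
  suc (m / n) * n       ∎
  where open ≤-Reasoning

-- `ℓ` acts as an integer logarithm of `suc n`. The `budget` keeps the `q` choices, at `3 * t * ℓ`
-- bits each, within `N / y`, which is a fraction `1/3k` of `N / v`.
numCodes-bound : ∀ n t k ℓ → 1 ≤ t → 1 ≤ k → suc n < 2 ^ suc ℓ → k + 3 ≤ ℓ →
  288 * k * k * (t ^ 3 * ℓ ^ 2) ≤ suc n →
  numCodes (suc n) t ^ (k * V (suc n) t) ≤ 2 ^ (2 ^ suc n * (k + 1))
numCodes-bound n₀ t@(suc _) k@(suc _) ℓ 1≤t 1≤k n<2^ k+3≤ℓ budget =
  extract-bound (numCodes n t) N k v q (3 * t * ℓ) M bound X≤ xqy≤N (m/n*n≤m (N * (3 * k + 1)) y)
  where
  open ≤-Reasoning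
  n = suc n₀
  N = 2 ^ n
  v = V n t
  y = 3 * k * v
  X = y + y
  L = 2 * t * ℓ
  instance
    v≢0 : NonZero v
    v≢0 = >-nonZero (V>0 n t)
    y≢0 : NonZero y
    y≢0 = m*n≢0 (3 * k) v
    nv≢0 : NonZero (n * v)
    nv≢0 = m*n≢0 n v
    ℓ≢0 : NonZero ℓ
    ℓ≢0 = >-nonZero (≤-trans (s≤s z≤n) k+3≤ℓ)
    X≢0 : NonZero X
    X≢0 = >-nonZero (≤-trans (>-nonZero⁻¹ y) (m≤m+n y y))
  -- `M` is `(1 + 1/3k) N / v` rounded down. The algorithm shrinks by `b / (1 + b)`, so rounding `b`
  -- down still leaves `suc b` above the quotient; `q` allows `L` halvings.
  M = N * (3 * k + 1) / y
  b = 8 * t * k * N / (n * v)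
  q = suc b * L

  1+ℓ≤2ℓ : suc ℓ ≤ 2 * ℓ
  1+ℓ≤2ℓ = ≤-trans (+-monoˡ-≤ ℓ (>-nonZero⁻¹ ℓ)) (≤-reflexive (cong (ℓ +_) (sym (+-identityʳ ℓ))))

  v≤2^L : v ≤ 2 ^ L
  v≤2^L = begin
    v                   ≤⟨ V≤[1+n]^t n t ⟩
    -- The strict inequality `n < 2 ^ suc ℓ` absorbs the extra one in `suc n`.
    suc n ^ t           ≤⟨ ^-monoˡ-≤ t (≤-trans n<2^ (^-monoʳ-≤ 2 1+ℓ≤2ℓ)) ⟩
    (2 ^ (2 * ℓ)) ^ t   ≡⟨ ^-*-assoc 2 (2 * ℓ) t ⟩
    2 ^ (2 * ℓ * t)     ≡⟨ cong (2 ^_) (swapₘ ℓ t) ⟩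
    2 ^ L               ∎
    where
    swapₘ : ∀ ℓ t → 2 * ℓ * t ≡ 2 * t * ℓ
    swapₘ = solve-∀

  4tℓ≤n : 4 * t * ℓ ≤ n
  4tℓ≤n = begin
    4 * t * ℓ                                   ≤⟨ m≤m*n (4 * t * ℓ) (72 * k * k * t * t * ℓ) {{m*n≢0 (72 * k * k * t * t) ℓ}} ⟩
    4 * t * ℓ * (72 * k * k * t * t * ℓ)        ≡⟨ expand k t ℓ ⟩
    288 * k * k * (t * (t * (t * 1)) * (ℓ * (ℓ * 1))) ≤⟨ budget ⟩
    n                                           ∎
    where
    expand : ∀ k t ℓ → 4 * t * ℓ * (72 * k * k * t * t * ℓ) ≡ 288 * k * k * (t * (t * (t * 1)) * (ℓ * (ℓ * 1)))
    expand = solve-∀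

  nv≤N : n * v ≤ N
  nv≤N = begin
    n * v                   ≤⟨ *-mono-≤ (≤-trans (<⇒≤ n<2^) (^-monoʳ-≤ 2 1+ℓ≤2ℓ)) v≤2^L ⟩
    2 ^ (2 * ℓ) * 2 ^ L     ≡⟨ ^-distribˡ-+-* 2 (2 * ℓ) L ⟨
    2 ^ (2 * ℓ + L)         ≤⟨ ^-monoʳ-≤ 2 (begin
      2 * ℓ + L               ≤⟨ +-monoˡ-≤ L (*-monoˡ-≤ ℓ (m≤m*n 2 t)) ⟩
      L + L                   ≡⟨ fourfold t ℓ ⟩
      4 * t * ℓ               ≤⟨ 4tℓ≤n ⟩
      n                       ∎) ⟩
    2 ^ n                   ∎
    where
    fourfold : ∀ t ℓ → 2 * t * ℓ + 2 * t * ℓ ≡ 4 * t * ℓ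
    fourfold = solve-∀

  b-lower : 8 * t * k * N ≤ suc b * (n * v)
  b-lower = <⇒≤ (m<[1+m/n]*n (8 * t * k * N) (n * v))

  b-upper : suc b * (n * v) ≤ 16 * t * k * N
  b-upper = begin
    -- Rounding up to `suc b` costs one extra `n * v`; as this is at most `N`, it no more than
    -- doubles the main term.
    n * v + b * (n * v)              ≤⟨ +-mono-≤ nv≤N (m/n*n≤m (8 * t * k * N) (n * v)) ⟩
    N + 8 * t * k * N                ≤⟨ +-monoˡ-≤ (8 * t * k * N) (m≤n*m N (8 * t * k)) ⟩
    8 * t * k * N + 8 * t * k * N    ≡⟨ double t k N ⟩
    16 * t * k * N                   ∎
    where
    double : ∀ t k N → 8 * t * k * N + 8 * t * k * N ≡ 16 * t * k * N
    double = solve-∀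

  X≤ : X ≤ 2 ^ (3 * t * ℓ)
  X≤ = begin
    X                             ≡⟨ sixfold k v ⟩
    6 * k * v                     ≤⟨ *-mono-≤ (*-mono-≤ {6} {2 ^ 3} (s≤s (s≤s (s≤s (s≤s (s≤s (s≤s z≤n)))))) (<⇒≤ (m<2^m k))) v≤2^L ⟩
    2 ^ 3 * 2 ^ k * 2 ^ L         ≡⟨ cong (_* 2 ^ L) (^-distribˡ-+-* 2 3 k) ⟨
    2 ^ (3 + k) * 2 ^ L           ≡⟨ ^-distribˡ-+-* 2 (3 + k) L ⟨
    2 ^ (3 + k + L)               ≤⟨ ^-monoʳ-≤ 2 (begin
      3 + k + L                     ≤⟨ +-monoˡ-≤ L (≤-trans (≤-reflexive (+-comm 3 k)) k+3≤ℓ) ⟩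
      ℓ + L                         ≤⟨ +-monoˡ-≤ L (m≤n*m ℓ t) ⟩
      t * ℓ + L                     ≡⟨ threefold t ℓ ⟩
      3 * t * ℓ                     ∎) ⟩
    2 ^ (3 * t * ℓ)               ∎
    where
    sixfold : ∀ k v → 3 * k * v + 3 * k * v ≡ 6 * k * v
    sixfold = solve-∀
    threefold : ∀ t ℓ → t * ℓ + 2 * t * ℓ ≡ 3 * t * ℓ
    threefold = solve-∀

  xqy≤N : 3 * t * ℓ * (q * y) ≤ N
  xqy≤N = *-cancelˡ-≤ n (begin
    -- The 18 collects the factors 3, 2 and 3 of `3 * t * ℓ`, `L` and `y`; with the 16 of `b-upper`
    -- it gives the 288 of `budget`.
    n * (3 * t * ℓ * (q * y))                      ≡⟨ gather n t ℓ (suc b) k v ⟩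
    18 * k * (t * t) * (ℓ * ℓ) * (suc b * (n * v)) ≤⟨ *-monoʳ-≤ (18 * k * (t * t) * (ℓ * ℓ)) b-upper ⟩
    18 * k * (t * t) * (ℓ * ℓ) * (16 * t * k * N)  ≡⟨ spend t ℓ k N ⟩
    288 * k * k * (t * (t * (t * 1)) * (ℓ * (ℓ * 1))) * N ≤⟨ *-monoˡ-≤ N budget ⟩
    n * N                                          ∎)
    where
    gather : ∀ n t ℓ b k v → n * (3 * t * ℓ * (b * (2 * t * ℓ) * (3 * k * v))) ≡ 18 * k * (t * t) * (ℓ * ℓ) * (b * (n * v))
    gather = solve-∀
    spend : ∀ t ℓ k N → 18 * k * (t * t) * (ℓ * ℓ) * (16 * t * k * N) ≡ 288 * k * k * (t * (t * (t * 1)) * (ℓ * (ℓ * 1))) * N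
    spend = solve-∀

  M-large : N * (3 * k + 1) < suc M * y
  M-large = m<[1+m/n]*n (N * (3 * k + 1)) y

  N<[1+M]*2^L : N < suc M * 2 ^ L
  N<[1+M]*2^L = <-≤-trans (*-cancelʳ-< (3 * k) N (suc M * v) (begin-strict
    N * (3 * k)            ≤⟨ *-monoʳ-≤ N (m≤m+n (3 * k) 1) ⟩
    N * (3 * k + 1)        <⟨ M-large ⟩
    suc M * (3 * k * v)    ≡⟨ swapₘ (suc M) (3 * k) v ⟩
    suc M * v * (3 * k)    ∎)) (*-monoʳ-≤ (suc M) v≤2^L)
    where
    swapₘ : ∀ m c v → m * (c * v) ≡ m * v * c
    swapₘ = solve-∀

  small : N * b ^ q < suc M * suc b ^ q
  small with b ^ q | 2^L*a^[1+a]L≤[1+a]^[1+a]L b L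
  -- Zero is separated because multiplying a strict inequality by `p` needs `p` positive.
  ... | zero      | _ = ≤-trans (s≤s (≤-reflexive (*-zeroʳ N))) (*-mono-≤ {1} {suc M} (s≤s z≤n) (m^n>0 (suc b) q))
  ... | p@(suc _) | h = begin-strict
    N * p                  <⟨ *-monoˡ-< p N<[1+M]*2^L ⟩
    suc M * 2 ^ L * p      ≡⟨ *-assoc (suc M) (2 ^ L) p ⟩
    suc M * (2 ^ L * p)    ≤⟨ *-monoʳ-≤ (suc M) h ⟩
    suc M * suc b ^ q      ∎

  open Container (far? {n} t) (λ {x} {y} → subst (2 * t + 1 ≤_) (dist-sym x y))
    (λ x → <⇒≱ (≤-trans (s≤s (≤-reflexive (dist-refl x))) (m≤n+m 1 (2 * t))))

  bound : numCodes n t * X ^ N ≤ suc X ^ N * X ^ q * 2 ^ M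
  -- `numCodes n t` unfolds to `count (allSubs n)`, so the algorithm starts from the whole cube with
  -- `s = N`.
  bound = container-bound X b M (high-degree-vertex t k b M 1≤k M-large b-lower) N q (allSubs n)
    (allSubs-unique n) (≤-reflexive (length-allSubs n))
    (subst (λ z → z * b ^ q < suc M * suc b ^ q) (sym (length-allSubs n)) small)

-- The factor `1 + o(1)` becomes `(k + 1) / k` for every `k` and all large `n`, with the quotient in
-- the exponent cleared by the power `k * V n (t n)`. The limit in the hypothesis is cubed and
-- likewise given by one bound for each `m`.
theorem5p1 : (t : ℕ → ℕ) → (∀ n → 1 ≤ t n)
    → (∀ m → ∃ λ N → ∀ n → N ≤ n → suc m * (t n ^ 3 * ⌊log₂ n ⌋ ^ 2) < n)
    → ∀ k → 1 ≤ k → ∃ λ N → ∀ n → N ≤ n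
    → numCodes n (t n) ^ (k * V n (t n)) ≤ 2 ^ (2 ^ n * (k + 1))
theorem5p1 t 1≤t t≪ k 1≤k with t≪ (288 * k * k)
-- The summand `2 ^ (k + 3)` forces `k + 3 ≤ ⌊log₂ n ⌋` and excludes `n = 0`.
... | N₀ , budget = N₀ + 2 ^ (k + 3) , large
  where
  large : ∀ n → N₀ + 2 ^ (k + 3) ≤ n → numCodes n (t n) ^ (k * V n (t n)) ≤ 2 ^ (2 ^ n * (k + 1))
  large zero    N≤0 = contradiction (≤-trans (m^n>0 2 (k + 3)) (m+n≤o⇒n≤o N₀ N≤0)) λ ()
  large n@(suc n₀) N≤n = numCodes-bound n₀ (t n) k ⌊log₂ n ⌋ (1≤t n) 1≤k (n<2^[1+⌊log₂n⌋] n)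
    (subst (_≤ ⌊log₂ n ⌋) (⌊log₂[2^n]⌋≡n (k + 3)) (⌊log₂⌋-mono-≤ (m+n≤o⇒n≤o N₀ N≤n)))
    (≤-trans (*-monoˡ-≤ (t n ^ 3 * ⌊log₂ n ⌋ ^ 2) (n≤1+n (288 * k * k))) (<⇒≤ (budget n (m+n≤o⇒m≤o N₀ N≤n))))
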